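{- There is a constant $c>0$ such that for every $n\ge 3$ and every initial coloring of the cycle $C_n$, the stabilization time of the Random Majority Model (RMM) on $C_n$ is at most $c n^2$; i.e., the stabilization time of RMM on $C_n$ is in $\mathcal{O}(n^2)$.
   Context: A coloring of a graph is a map from its nodes to $\{b,w\}$. In the Random Majority Model (RMM), all nodes update simultaneously in each round: a node adopts the color strictly more frequent among its neighbors in the previous round, and in case of a tie it chooses blue or white independently and uniformly at random. RMM is a Markov chain on colorings; in the directed graph on colorings with an edge $s\to s'$ whenever the transition has positive probability, an absorbing component is a maximal strongly connected component with no outgoing edge. The stabilization time is the expected number of rounds until the process reaches an absorbing component. -}

module Defs where

open import Data.Bool.Base using (if_then_else_)
open import Data.Fin.Base using (Fin; toℕ)
open import Data.Integer.Base using (+_)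
open import Data.List.Base using (List; []; _∷_; foldr; map; length; filter; allFin; cartesianProductWith)
open import Data.List.Membership.Propositional using (_∈_)
open import Data.List.Membership.Propositional.Properties using (∈-cartesianProductWith⁺)
open import Data.List.Relation.Unary.All as All using ()
open import Data.List.Relation.Unary.Any using (here; there)
open import Data.Nat.Base as ℕ using (ℕ; zero; suc)
import Data.Nat.Properties as ℕ
open import Data.Product.Base using (Σ; _×_; _,_)
open import Data.Rational.Base using (ℚ; 0ℚ; 1ℚ; ½; _+_; _*_; _<_; _≤_; _/_)
open import Data.Rational.Properties using (_<?_)
open import Data.Sum.Base using (_⊎_; inj₁; inj₂; swap)
open import Data.Vec.Base using (Vec; []; _∷_; lookup)
import Data.Vec.Properties as Vec
open import Level using (0ℓ)
open import Relation.Binary.Construct.Closure.ReflexiveTransitive using (Star; ε; _◅_; _◅◅_)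
open import Relation.Binary.Core using (Rel)
open import Relation.Binary.Definitions using (Decidable; DecidableEquality; Symmetric; tri<; tri≈; tri>)
open import Relation.Binary.PropositionalEquality using (_≡_; refl; sym)
open import Relation.Nullary using (¬_; Dec; yes; no; does)
open import Relation.Nullary.Decidable using (map′; _×-dec_; _⊎-dec_; _→-dec_)
open import Relation.Unary using (Pred; _⊆_)

sumℚ : List ℚ → ℚ
sumℚ = foldr _+_ 0ℚ

productℚ : List ℚ → ℚ
productℚ = foldr _*_ 1ℚ

fromℕ : ℕ → ℚ
fromℕ k = + k / 1

allVecs : {A : Set} → List A → (n : ℕ) → List (Vec A n)
allVecs xs zero    = [] ∷ []
allVecs xs (suc n) = cartesianProductWith _∷_ xs (allVecs xs n)

∈-allVecs : {A : Set} {xs : List A} → (∀ x → x ∈ xs) →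
            ∀ {n} (v : Vec A n) → v ∈ allVecs xs n
∈-allVecs all []      = here refl
∈-allVecs all (x ∷ v) = ∈-cartesianProductWith⁺ _∷_ (all x) (∈-allVecs all v)

-- Via decides reachability (Warshall), so that membership in an absorbing component is decidable.

module Warshall {A : Set} (_≟_ : DecidableEquality A)
                (_⟶_ : Rel A 0ℓ) (_⟶?_ : Decidable _⟶_) where

  -- Via L x y: there is a walk from x to y with inner vertices in L.
  Via : List A → Rel A 0ℓ
  Via []      x y = x ≡ y ⊎ x ⟶ y
  Via (k ∷ L) x y = Via L x y ⊎ (Via L x k × Via L k y)

  via? : ∀ L → Decidable (Via L)
  via? []      x y = (x ≟ y) ⊎-dec (x ⟶? y)
  via? (k ∷ L) x y = via? L x y ⊎-dec (via? L x k ×-dec via? L k y)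

  Via⇒Star : ∀ L {x y} → Via L x y → Star _⟶_ x y
  Via⇒Star []      (inj₁ refl)    = ε
  Via⇒Star []      (inj₂ e)       = e ◅ ε
  Via⇒Star (k ∷ L) (inj₁ p)       = Via⇒Star L p
  Via⇒Star (k ∷ L) (inj₂ (p , q)) = Via⇒Star L p ◅◅ Via⇒Star L q

  into : ∀ {L k x} → Via (k ∷ L) x k → Via L x k
  into (inj₁ p)       = p
  into (inj₂ (p , _)) = p

  outof : ∀ {L k y} → Via (k ∷ L) k y → Via L k y
  outof (inj₁ p)       = p
  outof (inj₂ (_ , p)) = p

  join : ∀ {L j x y} → j ∈ L → Via L x j → Via L j y → Via L x y
  join {k ∷ L} (here refl) p q = inj₂ (into {L} p , outof {L} q)
  join {k ∷ L} (there j∈) (inj₁ p)       (inj₁ q)       = inj₁ (join j∈ p q)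
  join {k ∷ L} (there j∈) (inj₁ p)       (inj₂ (q , r)) = inj₂ (join j∈ p q , r)
  join {k ∷ L} (there j∈) (inj₂ (p , q)) (inj₁ r)       = inj₂ (p , join j∈ q r)
  join {k ∷ L} (there j∈) (inj₂ (p , _)) (inj₂ (_ , r)) = inj₂ (p , r)

  base : ∀ L {x y} → x ≡ y ⊎ x ⟶ y → Via L x y
  base []      p = p
  base (k ∷ L) p = inj₁ (base L p)

  module _ {L : List A} (all : ∀ x → x ∈ L) where

    Star⇒Via : ∀ {x y} → Star _⟶_ x y → Via L x y
    Star⇒Via ε       = base L (inj₁ refl)
    Star⇒Via (e ◅ p) = join (all _) (base L (inj₂ e)) (Star⇒Via p)

    star? : Decidable (Star _⟶_)
    star? x y = map′ (Via⇒Star L) Star⇒Via (via? L x y)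

module Components {A : Set} (_⟶_ : Rel A 0ℓ) where

  StronglyConnected : Pred A 0ℓ → Set
  StronglyConnected C = ∀ {x y} → C x → C y → Star _⟶_ x y

  record IsAbsorbingComponent (C : Pred A 0ℓ) : Set₁ where
    field
      stronglyConnected : StronglyConnected C
      maximal           : ∀ {D : Pred A 0ℓ} → StronglyConnected D → C ⊆ D → D ⊆ C
      noOutgoingEdge    : ∀ {x y} → C x → x ⟶ y → C y

  InAbsorbingComponent : A → Set₁
  InAbsorbingComponent x = Σ (Pred A 0ℓ) λ C → IsAbsorbingComponent C × C x

  Recurrent : A → Set
  Recurrent x = ∀ y → Star _⟶_ x y → Star _⟶_ y x

  Recurrent⇒InAbsorbing : ∀ {x} → Recurrent x → InAbsorbingComponent x
  Recurrent⇒InAbsorbing {x} rec = Star _⟶_ x , isAbsorbing , ε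
    where
    isAbsorbing : IsAbsorbingComponent (Star _⟶_ x)
    isAbsorbing = record
      { stronglyConnected = λ p q → rec _ p ◅◅ q
      ; maximal           = λ sc C⊆D d → sc (C⊆D ε) d
      ; noOutgoingEdge    = λ p e → p ◅◅ (e ◅ ε)
      }

  InAbsorbing⇒Recurrent : ∀ {x} → InAbsorbingComponent x → Recurrent x
  InAbsorbing⇒Recurrent (C , isAbs , x∈C) y p = stronglyConnected (closed x∈C p) x∈C
    where
    open IsAbsorbingComponent isAbs
    closed : ∀ {u v} → C u → Star _⟶_ u v → C v
    closed c ε       = c
    closed c (e ◅ p) = closed (noOutgoingEdge c e) p

  module _ (_≟_ : DecidableEquality A) (_⟶?_ : Decidable _⟶_)
           {L : List A} (all : ∀ x → x ∈ L) where

    inAbsorbingComponent? : ∀ x → Dec (InAbsorbingComponent x)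
    inAbsorbingComponent? x =
      map′ (λ r → Recurrent⇒InAbsorbing (λ y → All.lookup r (all y)))
           (λ i → All.tabulate (λ {y} _ → InAbsorbing⇒Recurrent i y))
           (All.all? (λ y → reach? x y →-dec reach? y x) L)
      where
      reach? : Decidable (Star _⟶_)
      reach? = Warshall.star? _≟_ _⟶_ _⟶?_ all

record Graph (n : ℕ) : Set₁ where
  field
    Adj    : Rel (Fin n) 0ℓ
    adj?   : Decidable Adj
    symm   : Symmetric Adj
    irrefl : ∀ {v} → ¬ Adj v v

-- j is the cyclic successor of i.
Next : ∀ {n} → Rel (Fin n) 0ℓ
Next {n} i j = toℕ j ≡ suc (toℕ i) ⊎ (suc (toℕ i) ≡ n × toℕ j ≡ 0)

next? : ∀ {n} → Decidable (Next {n})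
next? {n} i j =
  (toℕ j ℕ.≟ suc (toℕ i)) ⊎-dec ((suc (toℕ i) ℕ.≟ n) ×-dec (toℕ j ℕ.≟ 0))

next-irrefl : ∀ {n} → 3 ℕ.≤ n → {v : Fin n} → ¬ Next v v
next-irrefl n≥3 (inj₁ eq) = ℕ.1+n≢n (sym eq)
next-irrefl n≥3 {v} (inj₂ (eq , v≡0)) with toℕ v
next-irrefl (ℕ.s≤s ()) (inj₂ (refl , refl)) | .0

cycle : (n : ℕ) → 3 ℕ.≤ n → Graph n
cycle n n≥3 = record
  { Adj    = λ i j → Next i j ⊎ Next j i
  ; adj?   = λ i j → next? i j ⊎-dec next? j i
  ; symm   = swap
  ; irrefl = λ { (inj₁ p) → next-irrefl n≥3 p ; (inj₂ p) → next-irrefl n≥3 p }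
  }

data Color : Set where
  b w : Color

_≟ᶜ_ : DecidableEquality Color
b ≟ᶜ b = yes refl
b ≟ᶜ w = no λ ()
w ≟ᶜ b = no λ ()
w ≟ᶜ w = yes refl

other : Color → Color
other b = w
other w = b

Coloring : ℕ → Set
Coloring n = Vec Color n

allColorings : (n : ℕ) → List (Coloring n)
allColorings = allVecs (b ∷ w ∷ [])

∈-allColorings : ∀ {n} (s : Coloring n) → s ∈ allColorings n
∈-allColorings = ∈-allVecs λ { b → here refl ; w → there (here refl) }

module RMM {n : ℕ} (G : Graph n) where
  open Graph G

  neighborsColored : Coloring n → Fin n → Color → ℕ
  neighborsColored s v c =
    length (filter (λ u → adj? v u ×-dec (lookup s u ≟ᶜ c)) (allFin n))

  -- Probability that v has color c in the round after s.
  colorProb : Coloring n → Fin n → Color → ℚ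
  colorProb s v c with ℕ.<-cmp (neighborsColored s v c) (neighborsColored s v (other c))
  ... | tri< _ _ _ = 0ℚ
  ... | tri≈ _ _ _ = ½
  ... | tri> _ _ _ = 1ℚ

  -- The nodes choose independently.
  transProb : Coloring n → Coloring n → ℚ
  transProb s s′ = productℚ (map (λ v → colorProb s v (lookup s′ v)) (allFin n))

  _⟶_ : Rel (Coloring n) 0ℓ
  s ⟶ s′ = 0ℚ < transProb s s′

  open Components _⟶_ public using (StronglyConnected; IsAbsorbingComponent; InAbsorbingComponent)

  absorbed? : ∀ s → Dec (InAbsorbingComponent s)
  absorbed? = Components.inAbsorbingComponent? _⟶_
    (Vec.≡-dec _≟ᶜ_) (λ s s′ → 0ℚ <? transProb s s′) ∈-allColorings

  -- A trajectory of N rounds from s is the vector of the N colorings after s.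
  trajectories : (N : ℕ) → List (Vec (Coloring n) N)
  trajectories = allVecs (allColorings n)

  trajectoryProb : ∀ {N} → Coloring n → Vec (Coloring n) N → ℚ
  trajectoryProb s []      = 1ℚ
  trajectoryProb s (x ∷ ω) = transProb s x * trajectoryProb x ω

  -- min(T, N), where T is the first round (the initial coloring being round 0)
  -- whose coloring lies in an absorbing component.
  hittingTime : ∀ {N} → Coloring n → Vec (Coloring n) N → ℕ
  hittingTime s []      = 0
  hittingTime s (x ∷ ω) = if does (absorbed? s) then 0 else suc (hittingTime x ω)

  -- E[min(T, N)] for the process started at s.
  truncatedTime : Coloring n → ℕ → ℚ
  truncatedTime s N =
    sumℚ (map (λ ω → trajectoryProb s ω * fromℕ (hittingTime s ω)) (trajectories N))

  -- E[T] ≤ B, where E[T] = sup_N E[min(T, N)] in [0,∞] (monotone convergence).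
  -- In particular this bound fails if T = ∞ with positive probability.
  StabilizationTime≤ : Coloring n → ℚ → Set
  StabilizationTime≤ s B = ∀ N → truncatedTime s N ≤ B

{-# OPTIONS --safe #-}

-- On a cycle a node adopts the majority color of its two neighbors, with a fair coin
-- in case of a tie; this is the same as copying a uniformly random neighbor.  Hence,
-- with colors read as spins ±1, the total spin M is a martingale, and since the nodes
-- choose independently E[M′²] = M² + (number of ties).  A coloring without ties evolves
-- deterministically, and each step it takes can be undone, so it lies in an absorbing
-- component.  Outside the absorbing components n² − M² therefore decreases by at least 1
-- per round in expectation, and 0 ≤ n² − M² ≤ n².

module Submission where

open import Defs
open import Data.Bool.Base using (true; false; if_then_else_)
open import Data.Fin.Base using (Fin; zero; suc; toℕ; fromℕ<; inject₁)
import Data.Fin.Base as Fin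
open import Data.Fin.Properties using (toℕ-fromℕ<; toℕ-injective; toℕ-fromℕ; toℕ-inject₁; toℕ<n; ¬∀⟶∃¬)
import Data.Integer.Base as ℤ
import Data.Integer.Properties as ℤ
open import Data.List.Base using (List; []; _∷_; _++_; map; filter; length; allFin; cartesianProductWith)
open import Data.List.Membership.Propositional using (_∈_)
open import Data.List.Membership.Propositional.Properties using (∈-filter⁺; ∈-filter⁻; ∈-allFin; ∈-map⁺)
open import Data.List.Membership.Propositional.Properties.WithK using (unique∧set⇒bag)
open import Data.List.Properties using (map-tabulate; map-∘; map-cong)
open import Data.List.Relation.Binary.BagAndSetEquality using (∼bag⇒↭)
open import Data.List.Relation.Binary.Permutation.Propositional using (_↭_; ↭⇒↭ₛ)
open import Data.List.Relation.Binary.Permutation.Propositional.Properties using (↭-length; map⁺)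
import Data.List.Relation.Binary.Permutation.Setoid.Properties as Permutation
open import Data.List.Relation.Unary.All using ([]; _∷_)
open import Data.List.Relation.Unary.AllPairs using ([]; _∷_)
open import Data.List.Relation.Unary.Any using (here; there)
open import Data.List.Relation.Unary.Unique.Propositional using (Unique)
import Data.List.Relation.Unary.Unique.Propositional.Properties as Unique
open import Data.Nat.Base as ℕ using (ℕ; zero; suc)
open import Data.Nat.Coprimality using (1-coprimeTo; sym)
import Data.Nat.Properties as ℕ
open import Data.Product.Base using (Σ; _×_; _,_; proj₁; proj₂)
open import Data.Rational.Base using (ℚ; 0ℚ; 1ℚ; ½; mkℚ; _<_; _≤_; _+_; _*_; _-_; -_; _/_; nonNegative)
open import Data.Rational.Properties
open import Data.Rational.Solver using (module +-*-Solver)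
open import Data.Sum.Base using (inj₁; inj₂)
open import Data.Vec.Base using (Vec; []; _∷_; lookup)
open import Function.Base using (id; _∘_)
open import Function.Bundles using (mk⇔)
open import Relation.Binary.Construct.Closure.ReflexiveTransitive using (Star; ε; _◅_; _◅◅_)
open import Relation.Binary.Definitions using (tri<; tri≈; tri>)
open import Relation.Binary.PropositionalEquality as ≡ using (_≡_; _≢_; refl; trans; cong; cong₂; subst; setoid)
open import Relation.Nullary using (¬_; yes; no; does; contradiction)
open import Relation.Nullary.Decidable using (_×-dec_; dec-true; dec-false)
open import Relation.Unary using (Decidable)

open +-*-Solver using (solve; con; _:+_; _:*_; _:-_; :-_; _:=_)

private variable
  A B C : Set
  n : ℕ

-- Rational arithmetic and the embedding of the naturals

-- For a variable `k` the normalization in `fromℕ k` is stuck on a gcd; rewriting to the explicit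
-- reduced fraction lets sums and products compute.
fromℕ≡mkℚ : ∀ k → fromℕ k ≡ mkℚ (ℤ.+ k) 0 (sym (1-coprimeTo k))
fromℕ≡mkℚ k = normalize-coprime (sym (1-coprimeTo k))

fromℕ-suc : ∀ k → fromℕ (suc k) ≡ 1ℚ + fromℕ k
fromℕ-suc k rewrite fromℕ≡mkℚ k = cong (λ i → (ℤ.+ 1 ℤ.+ i) / 1) (≡.sym (ℤ.*-identityʳ (ℤ.+ k)))

fromℕ-* : ∀ k l → fromℕ (k ℕ.* l) ≡ fromℕ k * fromℕ l
fromℕ-* k l rewrite fromℕ≡mkℚ k | fromℕ≡mkℚ l = cong (_/ 1) (ℤ.pos-* k l)

0≤p*q : ∀ {p q} → 0ℚ ≤ p → 0ℚ ≤ q → 0ℚ ≤ p * q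
0≤p*q {p} {q} 0≤p 0≤q = subst (_≤ p * q) (*-zeroʳ p) (*-monoˡ-≤-nonNeg p {{nonNegative 0≤p}} 0≤q)

0≤p² : ∀ p → 0ℚ ≤ p * p
0≤p² p with ≤-total 0ℚ p
... | inj₁ 0≤p = 0≤p*q 0≤p 0≤p
... | inj₂ p≤0 = subst (0ℚ ≤_) (solve 1 (λ p → :- p :* :- p := p :* p) refl p) (0≤p*q 0≤-p 0≤-p)
  where
  0≤-p : 0ℚ ≤ - p
  0≤-p = neg-antimono-≤ p≤0

p≤q⇒0≤q-p : ∀ {p q} → p ≤ q → 0ℚ ≤ q - p
p≤q⇒0≤q-p {p} {q} p≤q = subst (_≤ q - p) (+-inverseʳ p) (+-monoˡ-≤ (- p) p≤q)

p-q≤p : ∀ p {q} → 0ℚ ≤ q → p - q ≤ p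
p-q≤p p {q} 0≤q = subst (p - q ≤_) (+-identityʳ p) (+-monoʳ-≤ p (neg-antimono-≤ 0≤q))

-- Finite sums

∑ : List A → (A → ℚ) → ℚ
∑ xs f = sumℚ (map f xs)

∑-cong : ∀ (xs : List A) {f g} → (∀ x → f x ≡ g x) → ∑ xs f ≡ ∑ xs g
∑-cong xs eq = cong sumℚ (map-cong eq xs)

∑-++ : ∀ (xs ys : List A) f → ∑ (xs ++ ys) f ≡ ∑ xs f + ∑ ys f
∑-++ []       ys f = ≡.sym (+-identityˡ _)
∑-++ (x ∷ xs) ys f = trans (cong (f x +_) (∑-++ xs ys f)) (≡.sym (+-assoc (f x) _ _))

∑-cartesianProductWith : ∀ (h : A → B → C) xs ys f →
  ∑ (cartesianProductWith h xs ys) f ≡ ∑ xs (λ x → ∑ ys (λ y → f (h x y)))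
∑-cartesianProductWith h []       ys f = refl
∑-cartesianProductWith h (x ∷ xs) ys f = trans (∑-++ (map (h x) ys) _ f)
  (cong₂ _+_ (cong sumℚ (≡.sym (map-∘ ys))) (∑-cartesianProductWith h xs ys f))

∑-+ : ∀ (xs : List A) f g → ∑ xs (λ x → f x + g x) ≡ ∑ xs f + ∑ xs g
∑-+ []       f g = refl
∑-+ (x ∷ xs) f g = trans (cong (f x + g x +_) (∑-+ xs f g))
  (solve 4 (λ a b c d → a :+ b :+ (c :+ d) := a :+ c :+ (b :+ d)) refl (f x) (g x) _ _)

∑-*ˡ : ∀ (xs : List A) a f → ∑ xs (λ x → a * f x) ≡ a * ∑ xs f
∑-*ˡ []       a f = ≡.sym (*-zeroʳ a)
∑-*ˡ (x ∷ xs) a f = trans (cong (a * f x +_) (∑-*ˡ xs a f)) (≡.sym (*-distribˡ-+ a (f x) _))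

∑-mono : ∀ (xs : List A) {f g} → (∀ x → f x ≤ g x) → ∑ xs f ≤ ∑ xs g
∑-mono []       f≤g = ≤-refl
∑-mono (x ∷ xs) f≤g = +-mono-≤ (f≤g x) (∑-mono xs f≤g)

∑-zero : ∀ (xs : List A) → ∑ xs (λ _ → 0ℚ) ≡ 0ℚ
∑-zero []       = refl
∑-zero (x ∷ xs) = trans (+-identityˡ _) (∑-zero xs)

∑-nonNeg : ∀ (xs : List A) {f} → (∀ x → 0ℚ ≤ f x) → 0ℚ ≤ ∑ xs f
∑-nonNeg xs {f} 0≤f = subst (_≤ ∑ xs f) (∑-zero xs) (∑-mono xs 0≤f)

term≤∑ : ∀ {xs : List A} {f x} → (∀ x → 0ℚ ≤ f x) → x ∈ xs → f x ≤ ∑ xs f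
term≤∑ {xs = x ∷ xs} {f} 0≤f (here refl) =
  subst (_≤ f x + ∑ xs f) (+-identityʳ (f x)) (+-monoʳ-≤ (f x) (∑-nonNeg xs 0≤f))
term≤∑ {xs = y ∷ xs} {f} {x} 0≤f (there x∈xs) =
  subst (_≤ f y + ∑ xs f) (+-identityˡ (f x)) (+-mono-≤ (0≤f y) (term≤∑ 0≤f x∈xs))

∑-↭ : ∀ {xs ys : List A} f → xs ↭ ys → ∑ xs f ≡ ∑ ys f
∑-↭ f xs↭ys = Permutation.foldr-commMonoid (setoid ℚ) +-0-isCommutativeMonoid (↭⇒↭ₛ (map⁺ f xs↭ys))

map-allFin-suc : ∀ (f : Fin (suc n) → A) → map f (allFin (suc n)) ≡ f zero ∷ map (f ∘ suc) (allFin n)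
map-allFin-suc f = cong (f zero ∷_) (trans (map-tabulate suc f) (≡.sym (map-tabulate id (f ∘ suc))))

∑-allFin-suc : ∀ (f : Fin (suc n) → ℚ) → ∑ (allFin (suc n)) f ≡ f zero + ∑ (allFin n) (f ∘ suc)
∑-allFin-suc f = cong sumℚ (map-allFin-suc f)

∑-allFin-one : ∀ n → ∑ (allFin n) (λ _ → 1ℚ) ≡ fromℕ n
∑-allFin-one zero    = refl
∑-allFin-one (suc n) = trans (∑-allFin-suc {n} (λ _ → 1ℚ))
  (trans (cong (1ℚ +_) (∑-allFin-one n)) (≡.sym (fromℕ-suc n)))

-- In duplicate-free lists every multiplicity is at most one, so membership alone determines the
-- bag. Used to reindex sums and to compare neighbor lists.
unique∧same⇒↭ : ∀ {xs ys : List A} → Unique xs → Unique ys →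
  (∀ {x} → x ∈ xs → x ∈ ys) → (∀ {x} → x ∈ ys → x ∈ xs) → xs ↭ ys
unique∧same⇒↭ xs! ys! xs⊆ys ys⊆xs = ∼bag⇒↭ (unique∧set⇒bag xs! ys! (mk⇔ xs⊆ys ys⊆xs))

-- The left inverse keeps `map π (allFin n)` free of duplicates and the right inverse makes it
-- exhaustive, so it is a permutation of `allFin n`.
∑-allFin-reindex : ∀ {π π⁻¹ : Fin n → Fin n} → (∀ v → π⁻¹ (π v) ≡ v) → (∀ v → π (π⁻¹ v) ≡ v) →
  ∀ f → ∑ (allFin n) (f ∘ π) ≡ ∑ (allFin n) f
∑-allFin-reindex {n} {π} {π⁻¹} left right f = trans (cong sumℚ (map-∘ (allFin n)))
  (∑-↭ f (unique∧same⇒↭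
    (Unique.map⁺ (λ eq → trans (≡.sym (left _)) (trans (cong π⁻¹ eq) (left _))) (Unique.allFin⁺ n))
    (Unique.allFin⁺ n)
    (λ _ → ∈-allFin _)
    (λ {v} _ → subst (_∈ map π (allFin n)) (right v) (∈-map⁺ π (∈-allFin _)))))

-- Product measures on colorings

spin : Color → ℚ
spin b = 1ℚ
spin w = - 1ℚ

totalSpin : Coloring n → ℚ
totalSpin s = ∑ (allFin _) (spin ∘ lookup s)

-- With `P = colorProb s` this is `transProb s` by definition, so `expectation (colorProb s) f`
-- below is the expected value of `f` one round after `s`.
productProb : (Fin n → Color → ℚ) → Coloring n → ℚ
productProb P s = productℚ (map (λ v → P v (lookup s v)) (allFin _))

productProb-∷ : ∀ (P : Fin (suc n) → Color → ℚ) c s →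
  productProb P (c ∷ s) ≡ P zero c * productProb (P ∘ suc) s
productProb-∷ P c s = cong productℚ (map-allFin-suc (λ v → P v (lookup (c ∷ s) v)))

productProb-nonNeg : ∀ (P : Fin n → Color → ℚ) → (∀ v c → 0ℚ ≤ P v c) → ∀ s → 0ℚ ≤ productProb P s
productProb-nonNeg P 0≤P []      = nonNegative⁻¹ 1ℚ
productProb-nonNeg P 0≤P (c ∷ s) = subst (0ℚ ≤_) (≡.sym (productProb-∷ P c s))
  (0≤p*q (0≤P zero c) (productProb-nonNeg (P ∘ suc) (0≤P ∘ suc) s))

productProb-one : ∀ (P : Fin n → Color → ℚ) s → (∀ v → P v (lookup s v) ≡ 1ℚ) → productProb P s ≡ 1ℚ
productProb-one P []      P≡1 = refl
productProb-one P (c ∷ s) P≡1 = trans (productProb-∷ P c s)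
  (cong₂ _*_ (P≡1 zero) (productProb-one (P ∘ suc) s (P≡1 ∘ suc)))

productProb-zero : ∀ (P : Fin n → Color → ℚ) s v → P v (lookup s v) ≡ 0ℚ → productProb P s ≡ 0ℚ
productProb-zero P (c ∷ s) zero    P≡0 = trans (productProb-∷ P c s)
  (trans (cong (_* productProb (P ∘ suc) s) P≡0) (*-zeroˡ (productProb (P ∘ suc) s)))
productProb-zero P (c ∷ s) (suc v) P≡0 = trans (productProb-∷ P c s)
  (trans (cong (P zero c *_) (productProb-zero (P ∘ suc) s v P≡0)) (*-zeroʳ (P zero c)))

expectation : (Fin n → Color → ℚ) → (Coloring n → ℚ) → ℚ
expectation P f = ∑ (allColorings _) (λ s → productProb P s * f s)

-- Conditioning on the color of the first node: by independence its probability factors out. This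
-- drives the inductions on the number of nodes.
expectation-suc : ∀ (P : Fin (suc n) → Color → ℚ) f →
  expectation P f ≡
  P zero b * expectation (P ∘ suc) (f ∘ (b ∷_)) + P zero w * expectation (P ∘ suc) (f ∘ (w ∷_))
expectation-suc {n} P f = trans
  (∑-cartesianProductWith _∷_ (b ∷ w ∷ []) (allColorings n) (λ s → productProb P s * f s))
  (cong₂ _+_ (branch b) (trans (+-identityʳ _) (branch w)))
  where
  branch : ∀ c → ∑ (allColorings n) (λ s → productProb P (c ∷ s) * f (c ∷ s)) ≡
                 P zero c * expectation (P ∘ suc) (f ∘ (c ∷_))
  branch c = trans
    (∑-cong (allColorings n) λ s →
      trans (cong (_* f (c ∷ s)) (productProb-∷ P c s)) (*-assoc (P zero c) _ _))
    (∑-*ˡ (allColorings n) (P zero c) _)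

expectation-cong : ∀ (P : Fin n → Color → ℚ) {f g} → (∀ s → f s ≡ g s) → expectation P f ≡ expectation P g
expectation-cong P eq = ∑-cong (allColorings _) (λ s → cong (productProb P s *_) (eq s))

expectation-mono : ∀ (P : Fin n → Color → ℚ) → (∀ v c → 0ℚ ≤ P v c) →
  ∀ {f g} → (∀ s → f s ≤ g s) → expectation P f ≤ expectation P g
expectation-mono P 0≤P f≤g = ∑-mono (allColorings _) λ s →
  *-monoˡ-≤-nonNeg (productProb P s) {{nonNegative (productProb-nonNeg P 0≤P s)}} (f≤g s)

expectation-- : ∀ (P : Fin n → Color → ℚ) f g →
  expectation P (λ s → f s - g s) ≡ expectation P f - expectation P g
expectation-- {n} P f g = begin
  ∑ (allColorings n) (λ s → productProb P s * (f s - g s))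
    ≡⟨ ∑-cong (allColorings n) (λ s →
         solve 3 (λ p x y → p :* (x :- y) := p :* x :+ con (- 1ℚ) :* (p :* y)) refl (productProb P s) (f s) (g s)) ⟩
  ∑ (allColorings n) (λ s → productProb P s * f s + - 1ℚ * (productProb P s * g s))
    ≡⟨ ∑-+ (allColorings n) (λ s → productProb P s * f s) (λ s → - 1ℚ * (productProb P s * g s)) ⟩
  expectation P f + ∑ (allColorings n) (λ s → - 1ℚ * (productProb P s * g s))
    ≡⟨ cong (expectation P f +_) (∑-*ˡ (allColorings n) (- 1ℚ) (λ s → productProb P s * g s)) ⟩
  expectation P f + - 1ℚ * expectation P g
    ≡⟨ solve 2 (λ x y → x :+ con (- 1ℚ) :* y := x :- y) refl (expectation P f) (expectation P g) ⟩
  expectation P f - expectation P g ∎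
  where open ≡.≡-Reasoning

IsStochastic : (Fin n → Color → ℚ) → Set
IsStochastic P = ∀ v → P v b + P v w ≡ 1ℚ

expectation-const : ∀ (P : Fin n → Color → ℚ) → IsStochastic P → ∀ a → expectation P (λ _ → a) ≡ a
expectation-const {zero}  P P-sum a = trans (+-identityʳ _) (*-identityˡ a)
expectation-const {suc n} P P-sum a = trans (expectation-suc P (λ _ → a))
  (trans (cong₂ (λ x y → P zero b * x + P zero w * y) ih ih)
    (trans (≡.sym (*-distribʳ-+ a (P zero b) (P zero w)))
      (trans (cong (_* a) (P-sum zero)) (*-identityˡ a))))
  where
  ih = expectation-const (P ∘ suc) (P-sum ∘ suc) a

-- The expected spin of a node, blue counting as `1` and white as `- 1`.
mean : (Fin n → Color → ℚ) → Fin n → ℚ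
mean P v = P v b - P v w

-- The offset a makes the statement inductive: fixing the first color shifts it by ±1.
secondMoment : ∀ (P : Fin n → Color → ℚ) → IsStochastic P → ∀ a →
  expectation P (λ s → (a + totalSpin s) * (a + totalSpin s)) ≡
  (a + ∑ (allFin n) (mean P)) * (a + ∑ (allFin n) (mean P)) +
  ∑ (allFin n) (λ v → 1ℚ - mean P v * mean P v)
secondMoment {zero} P P-sum a =
  solve 1 (λ a → con 1ℚ :* ((a :+ con 0ℚ) :* (a :+ con 0ℚ)) :+ con 0ℚ :=
                 (a :+ con 0ℚ) :* (a :+ con 0ℚ) :+ con 0ℚ) refl a
secondMoment {suc n} P P-sum a = begin
  expectation P (λ s → (a + totalSpin s) * (a + totalSpin s))
    ≡⟨ expectation-suc P (λ s → (a + totalSpin s) * (a + totalSpin s)) ⟩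
  p * expectation P′ (λ s → (a + totalSpin (b ∷ s)) * (a + totalSpin (b ∷ s))) +
  q * expectation P′ (λ s → (a + totalSpin (w ∷ s)) * (a + totalSpin (w ∷ s)))
    ≡⟨ cong₂ (λ x y → p * x + q * y) (shifted b) (shifted w) ⟩
  p * ((a + 1ℚ + μ) * (a + 1ℚ + μ) + V) + q * ((a + - 1ℚ + μ) * (a + - 1ℚ + μ) + V)
    -- The ring solver cannot use `p + q ≡ 1`, so `q` is eliminated here and restored after the
    -- identity. In the identity, `1 - (p - q)²` is the variance of the first spin, whose square is
    -- always 1.
    ≡⟨ cong (λ q → p * ((a + 1ℚ + μ) * (a + 1ℚ + μ) + V) + q * ((a + - 1ℚ + μ) * (a + - 1ℚ + μ) + V)) q≡ ⟩
  p * ((a + 1ℚ + μ) * (a + 1ℚ + μ) + V) + (1ℚ - p) * ((a + - 1ℚ + μ) * (a + - 1ℚ + μ) + V)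
    ≡⟨ solve 4 (λ p a μ V →
         p :* ((a :+ con 1ℚ :+ μ) :* (a :+ con 1ℚ :+ μ) :+ V) :+
         (con 1ℚ :- p) :* ((a :+ con (- 1ℚ) :+ μ) :* (a :+ con (- 1ℚ) :+ μ) :+ V) :=
         (a :+ (p :- (con 1ℚ :- p) :+ μ)) :* (a :+ (p :- (con 1ℚ :- p) :+ μ)) :+
         (con 1ℚ :- (p :- (con 1ℚ :- p)) :* (p :- (con 1ℚ :- p)) :+ V)) refl p a μ V ⟩
  (a + (p - (1ℚ - p) + μ)) * (a + (p - (1ℚ - p) + μ)) + (1ℚ - (p - (1ℚ - p)) * (p - (1ℚ - p)) + V)
    ≡⟨ cong (λ q → (a + (p - q + μ)) * (a + (p - q + μ)) + (1ℚ - (p - q) * (p - q) + V)) q≡ ⟨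
  (a + (p - q + μ)) * (a + (p - q + μ)) + (1ℚ - (p - q) * (p - q) + V)
    ≡⟨ cong₂ (λ x y → (a + x) * (a + x) + y)
         (∑-allFin-suc (mean P)) (∑-allFin-suc (λ v → 1ℚ - mean P v * mean P v)) ⟨
  (a + ∑ (allFin (suc n)) (mean P)) * (a + ∑ (allFin (suc n)) (mean P)) +
  ∑ (allFin (suc n)) (λ v → 1ℚ - mean P v * mean P v) ∎
  where
  open ≡.≡-Reasoning
  P′ = P ∘ suc
  p = P zero b
  q = P zero w
  μ = ∑ (allFin n) (mean P′)
  V = ∑ (allFin n) (λ v → 1ℚ - mean P′ v * mean P′ v)
  q≡ : q ≡ 1ℚ - p
  q≡ = trans (solve 2 (λ p q → q := p :+ q :- p) refl p q) (cong (_- p) (P-sum zero))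
  totalSpin-∷ : ∀ c s → a + totalSpin (c ∷ s) ≡ a + spin c + totalSpin s
  totalSpin-∷ c s = trans (cong (a +_) (∑-allFin-suc (spin ∘ lookup (c ∷ s)))) (≡.sym (+-assoc a (spin c) _))
  shifted : ∀ c → expectation P′ (λ s → (a + totalSpin (c ∷ s)) * (a + totalSpin (c ∷ s))) ≡
                  (a + spin c + μ) * (a + spin c + μ) + V
  shifted c = trans (expectation-cong P′ (λ s → cong (λ x → x * x) (totalSpin-∷ c s)))
                    (secondMoment P′ (P-sum ∘ suc) (a + spin c))

-- The process on an arbitrary graph

-- The case split of `colorProb` as a function of the two counts alone, so that the counts can be
-- rewritten and the result evaluated on numerals.
majorityProb : ℕ → ℕ → ℚ
majorityProb k l with ℕ.<-cmp k l
... | tri< _ _ _ = 0ℚ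
... | tri≈ _ _ _ = ½
... | tri> _ _ _ = 1ℚ

majorityProb-nonNeg : ∀ k l → 0ℚ ≤ majorityProb k l
majorityProb-nonNeg k l with ℕ.<-cmp k l
... | tri< _ _ _ = ≤-refl
... | tri≈ _ _ _ = nonNegative⁻¹ ½
... | tri> _ _ _ = nonNegative⁻¹ 1ℚ

majorityProb-sum : ∀ k l → majorityProb k l + majorityProb l k ≡ 1ℚ
majorityProb-sum k l with ℕ.<-cmp k l | ℕ.<-cmp l k
... | tri< _ _ _   | tri> _ _ _   = refl
... | tri≈ _ _ _   | tri≈ _ _ _   = refl
... | tri> _ _ _   | tri< _ _ _   = refl
-- The two comparisons are made separately; the remaining pairs of outcomes are inconsistent.
... | tri< k<l _ _ | tri< _ _ k≮l = contradiction k<l k≮l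
... | tri< k<l _ _ | tri≈ _ _ k≮l = contradiction k<l k≮l
... | tri≈ _ k≡l _ | tri< _ l≢k _ = contradiction (≡.sym k≡l) l≢k
... | tri≈ _ k≡l _ | tri> _ l≢k _ = contradiction (≡.sym k≡l) l≢k
... | tri> _ _ l<k | tri≈ l≮k _ _ = contradiction l<k l≮k
... | tri> _ _ l<k | tri> l≮k _ _ = contradiction l<k l≮k

module Process {n : ℕ} (G : Graph n) where
  open RMM G

  colorProb≡majorityProb : ∀ s v c →
    colorProb s v c ≡ majorityProb (neighborsColored s v c) (neighborsColored s v (other c))
  colorProb≡majorityProb s v c with ℕ.<-cmp (neighborsColored s v c) (neighborsColored s v (other c))
  ... | tri< _ _ _ = refl
  ... | tri≈ _ _ _ = refl
  ... | tri> _ _ _ = refl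

  colorProb-nonNeg : ∀ s v c → 0ℚ ≤ colorProb s v c
  colorProb-nonNeg s v c = subst (0ℚ ≤_) (≡.sym (colorProb≡majorityProb s v c))
    (majorityProb-nonNeg (neighborsColored s v c) (neighborsColored s v (other c)))

  colorProb-stochastic : ∀ s → IsStochastic (colorProb s)
  colorProb-stochastic s v = trans
    (cong₂ _+_ (colorProb≡majorityProb s v b) (colorProb≡majorityProb s v w))
    (majorityProb-sum (neighborsColored s v b) (neighborsColored s v w))

  -- The Markov property: conditioning on the coloring after the first round, the rest of the
  -- trajectory is one started from there.
  ∑-trajectories-suc : ∀ N s (f : Vec (Coloring n) (suc N) → ℚ) →
    ∑ (trajectories (suc N)) (λ ω → trajectoryProb s ω * f ω) ≡
    expectation (colorProb s) (λ x → ∑ (trajectories N) (λ ω → trajectoryProb x ω * f (x ∷ ω)))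
  ∑-trajectories-suc N s f = trans
    (∑-cartesianProductWith _∷_ (allColorings n) (trajectories N) (λ ω → trajectoryProb s ω * f ω))
    (∑-cong (allColorings n) λ x → trans
      (∑-cong (trajectories N) λ ω → *-assoc (transProb s x) (trajectoryProb x ω) (f (x ∷ ω)))
      (∑-*ˡ (trajectories N) (transProb s x) (λ ω → trajectoryProb x ω * f (x ∷ ω))))

  -- The factor `1ℚ` keeps the sum in the shape of `∑-trajectories-suc` for a constant function.
  ∑-trajectoryProb : ∀ N s → ∑ (trajectories N) (λ ω → trajectoryProb s ω * 1ℚ) ≡ 1ℚ
  ∑-trajectoryProb zero    s = refl
  ∑-trajectoryProb (suc N) s = trans (∑-trajectories-suc N s (λ _ → 1ℚ))
    (trans (expectation-cong (colorProb s) (∑-trajectoryProb N))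
      (expectation-const (colorProb s) (colorProb-stochastic s) 1ℚ))

  truncatedTime-absorbed : ∀ {s} → InAbsorbingComponent s → ∀ N → truncatedTime s N ≡ 0ℚ
  truncatedTime-absorbed {s} absorbed N = trans
    (∑-cong (trajectories N) λ ω →
      trans (cong (λ k → trajectoryProb s ω * fromℕ k) (hittingTime≡0 ω)) (*-zeroʳ (trajectoryProb s ω)))
    (∑-zero (trajectories N))
    where
    hittingTime≡0 : ∀ {N} (ω : Vec (Coloring n) N) → hittingTime s ω ≡ 0
    hittingTime≡0 []      = refl
    hittingTime≡0 (x ∷ ω) =
      cong (if_then 0 else suc (hittingTime x ω)) (dec-true (absorbed? s) absorbed)

  -- First-step analysis: outside the absorbing components the first round always counts, and since
  -- the trajectory probabilities sum to 1 it contributes exactly 1.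
  truncatedTime-suc : ∀ {s} → ¬ InAbsorbingComponent s → ∀ N →
    truncatedTime s (suc N) ≡ expectation (colorProb s) (λ x → 1ℚ + truncatedTime x N)
  truncatedTime-suc {s} ¬absorbed N = trans
    (∑-trajectories-suc N s (λ ω → fromℕ (hittingTime s ω)))
    (expectation-cong (colorProb s) λ x → begin
      ∑ (trajectories N) (λ ω → trajectoryProb x ω * fromℕ (hittingTime s (x ∷ ω)))
        ≡⟨ ∑-cong (trajectories N) (λ ω → trans
             (cong (trajectoryProb x ω *_) (fromℕ-hittingTime x ω))
             (*-distribˡ-+ (trajectoryProb x ω) 1ℚ (fromℕ (hittingTime x ω)))) ⟩
      ∑ (trajectories N) (λ ω → trajectoryProb x ω * 1ℚ + trajectoryProb x ω * fromℕ (hittingTime x ω))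
        ≡⟨ ∑-+ (trajectories N) (λ ω → trajectoryProb x ω * 1ℚ)
             (λ ω → trajectoryProb x ω * fromℕ (hittingTime x ω)) ⟩
      ∑ (trajectories N) (λ ω → trajectoryProb x ω * 1ℚ) + truncatedTime x N
        ≡⟨ cong (_+ truncatedTime x N) (∑-trajectoryProb N x) ⟩
      1ℚ + truncatedTime x N ∎)
    where
    open ≡.≡-Reasoning
    fromℕ-hittingTime : ∀ x (ω : Vec (Coloring n) N) →
      fromℕ (hittingTime s (x ∷ ω)) ≡ 1ℚ + fromℕ (hittingTime x ω)
    fromℕ-hittingTime x ω = trans
      (cong (λ d → fromℕ (if d then 0 else suc (hittingTime x ω))) (dec-false (absorbed? s) ¬absorbed))
      (fromℕ-suc (hittingTime x ω))

  -- Additive drift, by induction on the horizon. At horizon 0 or in an absorbing component the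
  -- truncated time is 0 and `Φ` is nonnegative; otherwise the induction hypothesis bounds the time
  -- after one round by `Φ`, and the drift condition pays for that round.
  drift⇒stabilizationTime≤ : (Φ : Coloring n → ℚ) → (∀ s → 0ℚ ≤ Φ s) →
    (∀ s → ¬ InAbsorbingComponent s → expectation (colorProb s) (λ x → 1ℚ + Φ x) ≤ Φ s) →
    ∀ s → StabilizationTime≤ s (Φ s)
  drift⇒stabilizationTime≤ Φ 0≤Φ drift s zero    = 0≤Φ s
  drift⇒stabilizationTime≤ Φ 0≤Φ drift s (suc N) with absorbed? s
  ... | yes absorbed = subst (_≤ Φ s) (≡.sym (truncatedTime-absorbed absorbed (suc N))) (0≤Φ s)
  ... | no ¬absorbed = subst (_≤ Φ s) (≡.sym (truncatedTime-suc ¬absorbed N)) (≤-trans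
    (expectation-mono (colorProb s) (colorProb-nonNeg s) λ x →
      +-monoʳ-≤ 1ℚ (drift⇒stabilizationTime≤ Φ 0≤Φ drift x N))
    (drift s ¬absorbed))

-- The cycle

-- `next` and `prev` turn the relation `Next`, from which adjacency is built, into functions that
-- name the two neighbors of a node.
next : Fin n → Fin n
next {suc m} v with suc (toℕ v) ℕ.<? suc m
... | yes v+1<n = fromℕ< v+1<n
... | no  _     = zero

prev : Fin n → Fin n
prev zero    = Fin.fromℕ _
prev (suc v) = inject₁ v

next-Next : (v : Fin n) → Next v (next v)
next-Next {suc m} v with suc (toℕ v) ℕ.<? suc m
... | yes v+1<n = inj₁ (toℕ-fromℕ< v+1<n)
... | no  v+1≮n = inj₂ (ℕ.≤-antisym (toℕ<n v) (ℕ.≮⇒≥ v+1≮n) , refl)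

prev-Next : (v : Fin n) → Next (prev v) v
prev-Next {suc m} zero    = inj₂ (cong suc (toℕ-fromℕ m) , refl)
prev-Next {suc m} (suc v) = inj₁ (cong suc (≡.sym (toℕ-inject₁ v)))

Next-functional : {i j k : Fin n} → Next i j → Next i k → j ≡ k
Next-functional (inj₁ p) (inj₁ q) = toℕ-injective (trans p (≡.sym q))
Next-functional {j = j} (inj₁ p) (inj₂ (q , _)) = contradiction (toℕ<n j) (ℕ.<-irrefl (trans p q))
Next-functional {k = k} (inj₂ (p , _)) (inj₁ q) = contradiction (toℕ<n k) (ℕ.<-irrefl (trans q p))
Next-functional (inj₂ (_ , p)) (inj₂ (_ , q)) = toℕ-injective (trans p (≡.sym q))

Next-injective : {i j k : Fin n} → Next i k → Next j k → i ≡ j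
Next-injective (inj₁ p) (inj₁ q) = toℕ-injective (ℕ.suc-injective (trans (≡.sym p) q))
Next-injective (inj₁ p) (inj₂ (_ , q)) = contradiction (trans (≡.sym q) p) λ ()
Next-injective (inj₂ (_ , p)) (inj₁ q) = contradiction (trans (≡.sym p) q) λ ()
Next-injective (inj₂ (p , _)) (inj₂ (q , _)) = toℕ-injective (ℕ.suc-injective (trans p (≡.sym q)))

-- `next` and `prev` are mutually inverse because both follow `Next`, which is functional and
-- injective.
next-prev : (v : Fin n) → next (prev v) ≡ v
next-prev v = Next-functional (next-Next (prev v)) (prev-Next v)

prev-next : (v : Fin n) → prev (next v) ≡ v
prev-next v = Next-injective (prev-Next (next v)) (next-Next v)

-- Returning after two steps means either `i = i + 2` or a wrap-around, which forces `n ≤ 2`. Hence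
-- the two neighbors of a node are distinct.
Next-asym : 3 ℕ.≤ n → {i j : Fin n} → Next i j → ¬ Next j i
Next-asym n≥3 (inj₁ p) (inj₁ q) =
  ℕ.<-irrefl (trans q (cong suc p)) (ℕ.m≤n⇒m≤1+n ℕ.≤-refl)
Next-asym n≥3 (inj₁ p) (inj₂ (q , r)) =
  ℕ.<-irrefl (≡.sym (trans (≡.sym q) (cong suc (trans p (cong suc r))))) n≥3
Next-asym n≥3 (inj₂ (p , r)) (inj₁ q) =
  ℕ.<-irrefl (≡.sym (trans (≡.sym p) (cong suc (trans q (cong suc r))))) n≥3
Next-asym n≥3 (inj₂ (p , r)) (inj₂ (q , _)) =
  ℕ.<-irrefl (≡.sym (trans (≡.sym q) (cong suc r))) (ℕ.<-trans (ℕ.n<1+n 1) n≥3)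

next≢prev : 3 ℕ.≤ n → (v : Fin n) → next v ≢ prev v
next≢prev n≥3 v eq = Next-asym n≥3 (next-Next v) (subst (λ u → Next u v) (≡.sym eq) (prev-Next v))

-- Majority of two neighbors as random copying

length-filter-map : ∀ {P : B → Set} (P? : Decidable P) (f : A → B) xs →
  length (filter P? (map f xs)) ≡ length (filter (P? ∘ f) xs)
length-filter-map P? f []       = refl
length-filter-map P? f (x ∷ xs) with does (P? (f x))
... | true  = cong suc (length-filter-map P? f xs)
... | false = length-filter-map P? f xs

-- Shaped like `neighborsColored`, with the neighbor list reduced to two colors.
count : Color → Color → Color → ℕ
count x y c = length (filter (_≟ᶜ c) (x ∷ y ∷ []))

-- One of x and y, chosen with equal probability, is copied.
copyProb : Color → Color → Color → ℚ
copyProb x y c = ½ * (indicator x + indicator y)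
  where
  indicator : Color → ℚ
  indicator z = if does (z ≟ᶜ c) then 1ℚ else 0ℚ

-- Two equal neighbors force the color under both rules, and two different ones give a fair coin
-- under both; this is special to degree two.
majority≡copy : ∀ x y c → majorityProb (count x y c) (count x y (other c)) ≡ copyProb x y c
majority≡copy b b b = refl
majority≡copy b b w = refl
majority≡copy b w b = refl
majority≡copy b w w = refl
majority≡copy w b b = refl
majority≡copy w b w = refl
majority≡copy w w b = refl
majority≡copy w w w = refl

copyProb-mean : ∀ x y → copyProb x y b - copyProb x y w ≡ ½ * (spin x + spin y)
copyProb-mean b b = refl
copyProb-mean b w = refl
copyProb-mean w b = refl
copyProb-mean w w = refl

copyProb-same : ∀ x → copyProb x x x ≡ 1ℚ
copyProb-same b = refl
copyProb-same w = refl

copyProb-different : ∀ {x c} → c ≢ x → copyProb x x c ≡ 0ℚ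
copyProb-different {b} {b} c≢x = contradiction refl c≢x
copyProb-different {b} {w} c≢x = refl
copyProb-different {w} {b} c≢x = refl
copyProb-different {w} {w} c≢x = contradiction refl c≢x

-- The variance of the new spin: 1 for a tie and 0 otherwise, so its sum over all nodes counts the
-- ties.
copyVariance : Color → Color → ℚ
copyVariance x y = 1ℚ - ½ * (spin x + spin y) * (½ * (spin x + spin y))

copyVariance-nonNeg : ∀ x y → 0ℚ ≤ copyVariance x y
copyVariance-nonNeg b b = ≤-refl
copyVariance-nonNeg b w = nonNegative⁻¹ 1ℚ
copyVariance-nonNeg w b = nonNegative⁻¹ 1ℚ
copyVariance-nonNeg w w = ≤-refl

copyVariance-tie : ∀ {x y} → x ≢ y → copyVariance x y ≡ 1ℚ
copyVariance-tie {b} {b} x≢y = contradiction refl x≢y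
copyVariance-tie {b} {w} x≢y = refl
copyVariance-tie {w} {b} x≢y = refl
copyVariance-tie {w} {w} x≢y = contradiction refl x≢y

module Cycle {n : ℕ} (n≥3 : 3 ℕ.≤ n) where
  open Graph (cycle n n≥3) using (adj?)
  open RMM (cycle n n≥3)
  open Process (cycle n n≥3)

  -- The filtered neighbor list and the filtered list `next v ∷ prev v ∷ []` have the same members
  -- and no duplicates, hence the same length.
  neighborsColored-cycle : ∀ s v c →
    neighborsColored s v c ≡ count (lookup s (next v)) (lookup s (prev v)) c
  neighborsColored-cycle s v c = trans (↭-length (unique∧same⇒↭
    (Unique.filter⁺ (λ u → adj? v u ×-dec (lookup s u ≟ᶜ c)) (Unique.allFin⁺ n))
    (Unique.filter⁺ (λ u → lookup s u ≟ᶜ c) ((next≢prev n≥3 v ∷ []) ∷ [] ∷ []))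
    (λ u∈ → let _ , adj , color = ∈-filter⁻ (λ u → adj? v u ×-dec (lookup s u ≟ᶜ c)) {xs = allFin n} u∈
            in ∈-filter⁺ (λ u → lookup s u ≟ᶜ c) (adjacent⇒∈ adj) color)
    (λ u∈ → let u∈₂ , color = ∈-filter⁻ (λ u → lookup s u ≟ᶜ c) {xs = next v ∷ prev v ∷ []} u∈
            in ∈-filter⁺ (λ u → adj? v u ×-dec (lookup s u ≟ᶜ c)) (∈-allFin _) (∈⇒adjacent u∈₂ , color))))
    (≡.sym (length-filter-map (_≟ᶜ c) (lookup s) (next v ∷ prev v ∷ [])))
    where
    adjacent⇒∈ : ∀ {u} → Graph.Adj (cycle n n≥3) v u → u ∈ next v ∷ prev v ∷ []
    adjacent⇒∈ (inj₁ p) = here (Next-functional p (next-Next v))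
    adjacent⇒∈ (inj₂ p) = there (here (Next-injective p (prev-Next v)))
    ∈⇒adjacent : ∀ {u} → u ∈ next v ∷ prev v ∷ [] → Graph.Adj (cycle n n≥3) v u
    ∈⇒adjacent (here refl)         = inj₁ (next-Next v)
    ∈⇒adjacent (there (here refl)) = inj₂ (prev-Next v)

  colorProb-cycle : ∀ s v c → colorProb s v c ≡ copyProb (lookup s (next v)) (lookup s (prev v)) c
  colorProb-cycle s v c = trans (colorProb≡majorityProb s v c)
    (trans (cong₂ majorityProb (neighborsColored-cycle s v c) (neighborsColored-cycle s v (other c)))
      (majority≡copy (lookup s (next v)) (lookup s (prev v)) c))

  -- Colorings without ties

  Agree : Coloring n → Fin n → Set
  Agree s v = lookup s (next v) ≡ lookup s (prev v)

  -- Without ties the update is deterministic: a node with any other color contributes a factor 0 to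
  -- the transition probability.
  tieless-step : ∀ {s t} → (∀ v → Agree s v) → s ⟶ t → ∀ v → lookup t v ≡ lookup s (next v)
  tieless-step {s} {t} agree s⟶t v with lookup t v ≟ᶜ lookup s (next v)
  ... | yes eq  = eq
  ... | no  neq = contradiction s⟶t (<-irrefl (≡.sym (productProb-zero (colorProb s) t v
    (trans (colorProb-cycle s v (lookup t v))
      (trans (cong (λ y → copyProb (lookup s (next v)) y (lookup t v)) (≡.sym (agree v))) (copyProb-different neq))))))

  tieless-⟶ : ∀ {s t} → (∀ v → Agree s v) → (∀ v → lookup t v ≡ lookup s (next v)) → s ⟶ t
  tieless-⟶ {s} {t} agree shift = subst (0ℚ <_)
    (≡.sym (productProb-one (colorProb s) t λ v → trans (colorProb-cycle s v (lookup t v))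
      (trans (cong₂ (copyProb (lookup s (next v))) (≡.sym (agree v)) (shift v))
        (copyProb-same (lookup s (next v))))))
    (positive⁻¹ 1ℚ)

  -- Without ties `s` is invariant under rotation by two steps. Its only successor is its rotation
  -- by one step, which is again tieless and which the next round rotates back to `s`.
  tieless-reverse : ∀ {s t} → (∀ v → Agree s v) → s ⟶ t → (∀ v → Agree t v) × t ⟶ s
  tieless-reverse {s} {t} agree s⟶t = agree-t , tieless-⟶ {t} {s} agree-t λ v → ≡.sym (lookup-next v)
    where
    shift : ∀ v → lookup t v ≡ lookup s (next v)
    shift = tieless-step {s} {t} agree s⟶t
    lookup-next : ∀ v → lookup t (next v) ≡ lookup s v
    lookup-next v = trans (shift (next v)) (trans (agree (next v)) (cong (lookup s) (prev-next v)))
    lookup-prev : ∀ v → lookup t (prev v) ≡ lookup s v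
    lookup-prev v = trans (shift (prev v)) (cong (lookup s) (next-prev v))
    agree-t : ∀ v → Agree t v
    agree-t v = trans (lookup-next v) (≡.sym (lookup-prev v))

  -- A walk is undone edge by edge, as absence of ties passes along it.
  tieless⇒recurrent : ∀ {s} → (∀ v → Agree s v) → ∀ t → Star _⟶_ s t → Star _⟶_ t s
  tieless⇒recurrent agree t ε            = ε
  tieless⇒recurrent agree t (s⟶u ◅ u⟶*t) with tieless-reverse agree s⟶u
  ... | agree-u , u⟶s = tieless⇒recurrent agree-u t u⟶*t ◅◅ (u⟶s ◅ ε)

  tieless⇒absorbed : ∀ {s} → (∀ v → Agree s v) → InAbsorbingComponent s
  tieless⇒absorbed agree = Components.Recurrent⇒InAbsorbing _⟶_ (tieless⇒recurrent agree)

  -- Evolution of the total spin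

  variance : Coloring n → ℚ
  variance s = ∑ (allFin n) (λ v → copyVariance (lookup s (next v)) (lookup s (prev v)))

  -- Since `Agree` is decidable on finitely many nodes, a coloring outside the absorbing components
  -- yields an explicit tie; it contributes 1 and all other terms are nonnegative.
  1≤variance : ∀ {s} → ¬ InAbsorbingComponent s → 1ℚ ≤ variance s
  1≤variance {s} ¬absorbed = subst (_≤ variance s) (copyVariance-tie (proj₂ tie))
    (term≤∑ (λ v → copyVariance-nonNeg (lookup s (next v)) (lookup s (prev v))) (∈-allFin (proj₁ tie)))
    where
    tie : Σ (Fin n) λ v → ¬ Agree s v
    tie = ¬∀⟶∃¬ n (Agree s) (λ v → lookup s (next v) ≟ᶜ lookup s (prev v)) (¬absorbed ∘ tieless⇒absorbed)

  mean-cycle : ∀ s v → mean (colorProb s) v ≡ ½ * (spin (lookup s (next v)) + spin (lookup s (prev v)))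
  mean-cycle s v = trans (cong₂ _-_ (colorProb-cycle s v b) (colorProb-cycle s v w))
    (copyProb-mean (lookup s (next v)) (lookup s (prev v)))

  -- Each spin enters the mean of both its neighbors with weight `½`; reindexing along the two
  -- rotations collects it once in total.
  totalSpin-martingale : ∀ s → ∑ (allFin n) (mean (colorProb s)) ≡ totalSpin s
  totalSpin-martingale s = begin
    ∑ (allFin n) (mean (colorProb s))
      ≡⟨ ∑-cong (allFin n) (mean-cycle s) ⟩
    ∑ (allFin n) (λ v → ½ * (σ (next v) + σ (prev v)))
      ≡⟨ ∑-*ˡ (allFin n) ½ (λ v → σ (next v) + σ (prev v)) ⟩
    ½ * ∑ (allFin n) (λ v → σ (next v) + σ (prev v))
      ≡⟨ cong (½ *_) (∑-+ (allFin n) (σ ∘ next) (σ ∘ prev)) ⟩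
    ½ * (∑ (allFin n) (σ ∘ next) + ∑ (allFin n) (σ ∘ prev))
      ≡⟨ cong₂ (λ x y → ½ * (x + y))
           (∑-allFin-reindex {π = next} {π⁻¹ = prev} prev-next next-prev σ)
           (∑-allFin-reindex {π = prev} {π⁻¹ = next} next-prev prev-next σ) ⟩
    ½ * (totalSpin s + totalSpin s)
      ≡⟨ solve 1 (λ x → con ½ :* (x :+ x) := x) refl (totalSpin s) ⟩
    totalSpin s ∎
    where
    open ≡.≡-Reasoning
    σ : Fin n → ℚ
    σ = spin ∘ lookup s

  spinSquare-step : ∀ s →
    expectation (colorProb s) (λ t → totalSpin t * totalSpin t) ≡ totalSpin s * totalSpin s + variance s
  spinSquare-step s = begin
    expectation (colorProb s) (λ t → totalSpin t * totalSpin t)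
      -- `secondMoment` is applied with offset 0, which has to be inserted first.
      ≡⟨ expectation-cong (colorProb s) (λ t → cong (λ x → x * x) (+-identityˡ (totalSpin t))) ⟨
    expectation (colorProb s) (λ t → (0ℚ + totalSpin t) * (0ℚ + totalSpin t))
      ≡⟨ secondMoment (colorProb s) (colorProb-stochastic s) 0ℚ ⟩
    (0ℚ + ∑ (allFin n) (mean (colorProb s))) * (0ℚ + ∑ (allFin n) (mean (colorProb s))) +
    ∑ (allFin n) (λ v → 1ℚ - mean (colorProb s) v * mean (colorProb s) v)
      ≡⟨ cong₂ (λ x y → x * x + y)
           (trans (+-identityˡ _) (totalSpin-martingale s))
           (∑-cong (allFin n) (λ v → cong (λ x → 1ℚ - x * x) (mean-cycle s v))) ⟩
    totalSpin s * totalSpin s + variance s ∎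
    where open ≡.≡-Reasoning

  -- The potential and its drift

  potential : Coloring n → ℚ
  potential s = fromℕ n * fromℕ n - totalSpin s * totalSpin s

  potential-nonNeg : ∀ s → 0ℚ ≤ potential s
  potential-nonNeg s = subst (0ℚ ≤_)
    -- The potential factors as `(n - M)(n - (- M))` for the total spin `M`, and both factors are
    -- nonnegative because `M` lies between `- n` and `n`.
    (solve 2 (λ x y → (x :- y) :* (x :- :- y) := x :* x :- y :* y) refl (fromℕ n) (totalSpin s))
    (0≤p*q (p≤q⇒0≤q-p spin≤n) (p≤q⇒0≤q-p -spin≤n))
    where
    spin≤1 : ∀ c → spin c ≤ 1ℚ
    spin≤1 b = ≤-refl
    spin≤1 w = ≤-trans (nonPositive⁻¹ (- 1ℚ)) (nonNegative⁻¹ 1ℚ)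
    -- The negation is written as a scalar multiple so that `∑-*ˡ` can pull it out of the sum.
    -spin≤1 : ∀ c → - 1ℚ * spin c ≤ 1ℚ
    -spin≤1 b = spin≤1 w
    -spin≤1 w = ≤-refl
    spin≤n : totalSpin s ≤ fromℕ n
    spin≤n = subst (totalSpin s ≤_) (∑-allFin-one n) (∑-mono (allFin n) (spin≤1 ∘ lookup s))
    -spin≤n : - totalSpin s ≤ fromℕ n
    -spin≤n = ≡.subst₂ _≤_
      (trans (∑-*ˡ (allFin n) (- 1ℚ) (spin ∘ lookup s))
        (solve 1 (λ x → con (- 1ℚ) :* x := :- x) refl (totalSpin s)))
      (∑-allFin-one n)
      (∑-mono (allFin n) (-spin≤1 ∘ lookup s))

  potential-drift : ∀ s → ¬ InAbsorbingComponent s →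
    expectation (colorProb s) (λ t → 1ℚ + potential t) ≤ potential s
  potential-drift s ¬absorbed = begin
    expectation (colorProb s) (λ t → 1ℚ + (K - totalSpin t * totalSpin t))
      -- Grouping `1ℚ + K` leaves a constant minus the squared spin, ready for linearity.
      ≡⟨ expectation-cong (colorProb s) (λ t → ≡.sym (+-assoc 1ℚ K (- (totalSpin t * totalSpin t)))) ⟩
    expectation (colorProb s) (λ t → 1ℚ + K - totalSpin t * totalSpin t)
      ≡⟨ expectation-- (colorProb s) (λ _ → 1ℚ + K) (λ t → totalSpin t * totalSpin t) ⟩
    expectation (colorProb s) (λ _ → 1ℚ + K) - expectation (colorProb s) (λ t → totalSpin t * totalSpin t)
      ≡⟨ cong₂ _-_ (expectation-const (colorProb s) (colorProb-stochastic s) (1ℚ + K)) (spinSquare-step s) ⟩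
    1ℚ + K - (totalSpin s * totalSpin s + variance s)
      ≡⟨ solve 3 (λ k x y → con 1ℚ :+ k :- (x :+ y) := k :- x :- (y :- con 1ℚ)) refl
           K (totalSpin s * totalSpin s) (variance s) ⟩
    potential s - (variance s - 1ℚ)
      ≤⟨ p-q≤p (potential s) (p≤q⇒0≤q-p (1≤variance ¬absorbed)) ⟩
    potential s ∎
    where
    open ≤-Reasoning
    K : ℚ
    K = fromℕ n * fromℕ n

  potential≤n² : ∀ s → potential s ≤ 1ℚ * fromℕ (n ℕ.^ 2)
  potential≤n² s = subst (potential s ≤_)
    (≡.sym (trans (*-identityˡ _) (trans (cong (λ k → fromℕ (n ℕ.* k)) (ℕ.*-identityʳ n)) (fromℕ-* n n))))
    (p-q≤p (fromℕ n * fromℕ n) (0≤p² (totalSpin s)))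

  stabilizationTime≤n² : ∀ s → StabilizationTime≤ s (1ℚ * fromℕ (n ℕ.^ 2))
  stabilizationTime≤n² s N =
    ≤-trans (drift⇒stabilizationTime≤ potential potential-nonNeg potential-drift s N) (potential≤n² s)

theorem2p5 : Σ ℚ λ c → 0ℚ < c × (∀ (n : ℕ) (n≥3 : 3 ℕ.≤ n) (s : Coloring n) → RMM.StabilizationTime≤ (cycle n n≥3) s (c * fromℕ (n ℕ.^ 2)))
-- The constant 1 suffices because the initial potential is at most `n²`.
theorem2p5 = 1ℚ , positive⁻¹ 1ℚ , λ n n≥3 → Cycle.stabilizationTime≤n² n≥3
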